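{- Let $D$ be a digraph whose underlying graph $G$ contains no subdivision of the Bean Graph, and let $vw$ be an edge of $D$. Then there is either a directed cycle, a directed double ray, or a directed minimal non-empty nibble of $G$ containing $vw$.
   Context: The Bean Graph consists of a ray $S$ starting at a vertex $u$ together with a ray $R$ disjoint from $S$ such that $u$ is adjacent to every vertex of $R$. For a set $X$ of vertices of $G$ with vertex set $V$, the cut $U_X$ is the set of edges with one end in $X$ and the other in $V\setminus X$; it is a nibble if the induced subgraph $G[X]$ is rayless. A minimal non-empty nibble is a non-empty nibble containing no other non-empty nibble. A set of edges of the form $U_X$ is directed (in $D$) if either all its edges are directed from $X$ to $V\setminus X$ or all are directed from $V\setminus X$ to $X$. Directed cycles and directed double rays are cycles and double rays in which all edges are oriented consistently along the cycle/double ray. -}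

module Defs where

open import Level using (0ℓ)
open import Data.Nat using (ℕ; zero; suc; _<_; _≤_; _+_)
open import Data.Integer as ℤ using (ℤ)
open import Data.Product using (Σ; Σ-syntax; ∃; ∃-syntax; _×_; _,_)
open import Data.Sum using (_⊎_)
open import Data.Empty using (⊥)
open import Relation.Nullary using (¬_)
open import Relation.Binary.PropositionalEquality using (_≡_; _≢_)

-- Digraphs (possibly infinite; parallel edges and loops allowed).
-- The underlying graph G has the same vertices and edges, with the
-- orientation forgotten.

record Digraph : Set₁ where
  field
    V    : Set
    E    : Set
    tail : E → V
    head : E → V

module _ (D : Digraph) where
  open Digraph D

  Joins : E → V → V → Set
  Joins e a b = (tail e ≡ a × head e ≡ b) ⊎ (tail e ≡ b × head e ≡ a)

  record Ray : Set where
    field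
      vx   : ℕ → V
      ed   : ℕ → E
      inj  : ∀ i j → vx i ≡ vx j → i ≡ j
      join : ∀ i → Joins (ed i) (vx i) (vx (suc i))

  record Path (a b : V) : Set where
    field
      len   : ℕ
      vx    : ℕ → V
      ed    : ℕ → E
      inj   : ∀ i j → i ≤ len → j ≤ len → vx i ≡ vx j → i ≡ j
      join  : ∀ i → i < len → Joins (ed i) (vx i) (vx (suc i))
      start : vx 0 ≡ a
      end   : vx len ≡ b

  Inner : ∀ {a b} → Path a b → V → Set
  Inner P v = Σ[ i ∈ ℕ ] (0 < i × i < Path.len P × Path.vx P i ≡ v)

  OnRay : Ray → V → Set
  OnRay R v = Σ[ i ∈ ℕ ] Ray.vx R i ≡ v

  -- G contains a subdivision of the Bean Graph: a ray S starting at u,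
  -- a ray R disjoint from S, branch vertices r_k = R (f k) of R with
  -- f strictly increasing and f 0 = 0 (R is the subdivided ray r_0 r_1 ...),
  -- and paths P k from u to r_k (the subdivided edges u r_k) whose inner
  -- vertices avoid S, R and the inner vertices of the other paths.
  record BeanSubdivision : Set where
    field
      S      : Ray
      R      : Ray
      disjSR : ∀ i j → Ray.vx S i ≢ Ray.vx R j
      f      : ℕ → ℕ
      f0     : f 0 ≡ 0
      fmono  : ∀ k → f k < f (suc k)
      P      : (k : ℕ) → Path (Ray.vx S 0) (Ray.vx R (f k))
      innS   : ∀ k v → Inner (P k) v → ¬ OnRay S v
      innR   : ∀ k v → Inner (P k) v → ¬ OnRay R v
      innP   : ∀ k l v → Inner (P k) v → Inner (P l) v → k ≡ l

  DirectedCycleThrough : E → Set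
  DirectedCycleThrough e0 =
    Σ[ n ∈ ℕ ] Σ[ vx ∈ (ℕ → V) ] Σ[ ed ∈ (ℕ → E) ]
      (0 < n
      × (∀ i j → i < n → j < n → vx i ≡ vx j → i ≡ j)
      × (∀ i → i < n → tail (ed i) ≡ vx i × head (ed i) ≡ vx (suc i))
      × vx n ≡ vx 0
      × Σ[ i ∈ ℕ ] (i < n × ed i ≡ e0))

  -- a directed double ray of D through e0 (oriented consistently;
  -- the opposite orientation is obtained by reindexing i ↦ -i)
  DirectedDoubleRayThrough : E → Set
  DirectedDoubleRayThrough e0 =
    Σ[ vx ∈ (ℤ → V) ] Σ[ ed ∈ (ℤ → E) ]
      ((∀ i j → vx i ≡ vx j → i ≡ j)
      × (∀ i → tail (ed i) ≡ vx i × head (ed i) ≡ vx (i ℤ.+ ℤ.1ℤ))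
      × Σ[ i ∈ ℤ ] ed i ≡ e0)

  VSet : Set₁
  VSet = V → Set

  ESet : Set₁
  ESet = E → Set

  _⊆_ : ESet → ESet → Set
  F ⊆ F' = ∀ e → F e → F' e

  _≐_ : ESet → ESet → Set
  F ≐ F' = (F ⊆ F') × (F' ⊆ F)

  Cut : VSet → ESet
  Cut X e = (X (tail e) × ¬ X (head e)) ⊎ (¬ X (tail e) × X (head e))

  Rayless : VSet → Set
  Rayless X = ¬ (Σ[ R ∈ Ray ] (∀ i → X (Ray.vx R i)))

  IsNibble : ESet → Set₁
  IsNibble F = Σ[ X ∈ VSet ] ((F ≐ Cut X) × Rayless X)

  NonEmpty : ESet → Set
  NonEmpty F = Σ[ e ∈ E ] F e

  MinNonEmptyNibble : ESet → Set₁
  MinNonEmptyNibble F =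
    IsNibble F × NonEmpty F
    × (∀ F' → IsNibble F' → NonEmpty F' → F' ⊆ F → F ⊆ F')

  DirectedCut : ESet → Set₁
  DirectedCut F = Σ[ X ∈ VSet ] ((F ≐ Cut X) ×
    ((∀ e → F e → X (tail e) × ¬ X (head e))
     ⊎ (∀ e → F e → ¬ X (tail e) × X (head e))))

{-# OPTIONS --safe #-}

-- Let A be the set of vertices reachable from w.  If v ∈ A there is a directed
-- cycle, and a ray directed out of w together with a ray directed into v gives
-- a double ray.  By symmetry we may therefore assume that v ∉ A and that no
-- directed ray leaves w.  If the component C of G − A containing v is rayless,
-- the cut of C is the required nibble.  Otherwise v starts a ray avoiding A;
-- let U be the set of all vertices starting such a ray and X its complement.
-- The cut of X consists of edges from U to A, and it is the required nibble as
-- soon as X is rayless.  A ray R in X meets A infinitely often.  In a shortest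
-- path tree of A with root w there is a vertex u having infinitely many
-- descendants on R but no child with this property, since otherwise a directed
-- ray would leave w.  The subtrees at the children of u contain an infinite fan
-- from u to R, and walking from u up to w and on to v extends a ray in U to one
-- starting at u, which makes a subdivided Bean Graph.

module Submission where

open import Defs
open import Level using (0ℓ)
open import Axiom.ExcludedMiddle using (ExcludedMiddle)
open import Data.Nat using (ℕ; zero; suc; pred; _+_; _∸_; _⊔_; _≤_; _<_; z≤n; s≤s; z<s)
open import Data.Nat.Properties
open import Data.Integer as ℤ using (ℤ; +_; -[1+_])
open import Data.Product as Product using (Σ; Σ-syntax; _×_; _,_; proj₁; proj₂)
open import Data.Sum as Sum using (_⊎_; inj₁; inj₂; [_,_]′)
open import Function using (_∘_)
open import Relation.Binary.Definitions using (tri<; tri≈; tri>)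
open import Relation.Binary.PropositionalEquality using (_≡_; _≢_; refl; sym; trans; cong; subst)
open import Relation.Nullary using (¬_; Dec; yes; no; contradiction)

-- Arithmetic, bounds and least elements

m∸[n∸i]≡[m∸n]+i : ∀ m n i → i ≤ n → n ≤ m → m ∸ (n ∸ i) ≡ (m ∸ n) + i
m∸[n∸i]≡[m∸n]+i m n zero _ _ = sym (+-identityʳ (m ∸ n))
m∸[n∸i]≡[m∸n]+i (suc m) (suc n) (suc i) (s≤s i≤n) (s≤s n≤m) =
  trans (+-∸-assoc 1 (≤-trans (m∸n≤m n i) n≤m))
        (trans (cong suc (m∸[n∸i]≡[m∸n]+i m n i i≤n n≤m)) (sym (+-suc (m ∸ n) i)))

uniform-bound : (Q : ℕ → ℕ → Set) → (∀ i → Σ[ M ∈ ℕ ] (∀ j → Q i j → j ≤ M)) →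
  ∀ N → Σ[ M ∈ ℕ ] (∀ i j → i ≤ N → Q i j → j ≤ M)
uniform-bound Q bound zero = proj₁ (bound 0) , λ { .0 j z≤n q → proj₂ (bound 0) j q }
uniform-bound Q bound (suc N) =
  M ⊔ M′ , λ i j i≤1+N q → [ (λ i<1+N → ≤-trans (below i j (≤-pred i<1+N) q) (m≤m⊔n M M′))
                           , (λ { refl → ≤-trans (proj₂ (bound (suc N)) j q) (m≤n⊔m M M′) })
                           ]′ (m≤n⇒m<n∨m≡n i≤1+N)
  where
  M  = proj₁ (uniform-bound Q bound N)
  M′ = proj₁ (bound (suc N))
  below = proj₂ (uniform-bound Q bound N)

module _ (em : ExcludedMiddle 0ℓ) where

  -- Applied to Σ-types, this also supplies the choice needed to build rays and fans step by step.
  ¬¬-elim : {P : Set} → ¬ ¬ P → P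
  ¬¬-elim {P} ¬¬p with em {P}
  ... | yes p = p
  ... | no ¬p = contradiction ¬p ¬¬p

  Least : (ℕ → Set) → Set
  Least P = Σ[ m ∈ ℕ ] (P m × (∀ k → P k → m ≤ k))

  least : (P : ℕ → Set) → ∀ {n} → P n → Least P
  least P {n} p = [ (λ l → l) , (λ lb → contradiction (lb n p) 1+n≰n) ]′ (search (suc n))
    where
    search : ∀ n → Least P ⊎ (∀ k → P k → n ≤ k)
    search zero = inj₂ λ _ _ → z≤n
    search (suc n) with search n
    ... | inj₁ l = inj₁ l
    ... | inj₂ lb with em {P n}
    ...   | yes p = inj₁ (n , p , lb)
    ...   | no ¬p = inj₂ λ k pk → ≤∧≢⇒< (lb k pk) λ { refl → ¬p pk }

  unbounded-or-bounded : (P : ℕ → Set) →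
    (∀ N → Σ[ j ∈ ℕ ] (N < j × P j)) ⊎ (Σ[ M ∈ ℕ ] (∀ j → P j → j ≤ M))
  unbounded-or-bounded P with em {Σ[ M ∈ ℕ ] (∀ j → P j → j ≤ M)}
  ... | yes b = inj₂ b
  ... | no ¬b = inj₁ λ N → ¬¬-elim λ ¬j → ¬b (N , λ j p → ≮⇒≥ λ N<j → ¬j (j , N<j , p))

  functional-bounded : {Q : ℕ → Set} → (∀ i j → Q i → Q j → i ≡ j) →
    Σ[ M ∈ ℕ ] (∀ j → Q j → j ≤ M)
  functional-bounded {Q} unique with em {Σ[ j ∈ ℕ ] Q j}
  ... | yes (i , q) = i , λ j q′ → ≤-reflexive (unique j i q′ q)
  ... | no ¬q = 0 , λ j q → contradiction (j , q) ¬q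

-- Reversal, rays and reachability

op : Digraph → Digraph
op D = record { V = V ; E = E ; tail = head ; head = tail }
  where open Digraph D

module _ (D : Digraph) where
  open Digraph D

  RayFromIn : VSet D → VSet D
  RayFromIn P x = Σ[ R ∈ Ray D ] (Ray.vx R 0 ≡ x × (∀ i → P (Ray.vx R i)))

  -- At `op D` this is a ray directed into its first vertex.
  OutRay : V → Set
  OutRay w = Σ[ vx ∈ (ℕ → V) ] Σ[ ed ∈ (ℕ → E) ]
    ((∀ i j → vx i ≡ vx j → i ≡ j)
    × (∀ i → tail (ed i) ≡ vx i × head (ed i) ≡ vx (suc i))
    × vx 0 ≡ w)

  data Reach (w : V) : ℕ → V → Set where
    here : Reach w 0 w
    step : ∀ {n} e → Reach w n (tail e) → Reach w (suc n) (head e)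

  Reachable : V → VSet D
  Reachable w x = Σ[ n ∈ ℕ ] Reach w n x

  Cut-respects : ExcludedMiddle 0ℓ → (X : VSet D) (e : E) → ∀ {a b} →
    Joins D e a b → ¬ Cut D X e → X a → X b
  Cut-respects em X e (inj₁ (refl , refl)) e∉ xa = ¬¬-elim em λ ¬xb → e∉ (inj₁ (xa , ¬xb))
  Cut-respects em X e (inj₂ (refl , refl)) e∉ xa = ¬¬-elim em λ ¬xb → e∉ (inj₂ (¬xb , xa))

module _ {D : Digraph} where
  open Digraph D

  dropRay : ℕ → Ray D → Ray D
  dropRay n R = record
    { vx = λ i → vx (n + i)
    ; ed = λ i → ed (n + i)
    ; inj = λ i j eq → +-cancelˡ-≡ n i j (inj (n + i) (n + j) eq)
    ; join = λ i → subst (Joins D (ed (n + i)) (vx (n + i))) (cong vx (sym (+-suc n i))) (join (n + i))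
    }
    where open Ray R

  consRay : ∀ {e x} (R : Ray D) → Joins D e x (Ray.vx R 0) → ¬ OnRay D R x → Ray D
  consRay {e} {x} R e-joins x∉R = record
    { vx = λ { zero → x ; (suc i) → vx i }
    ; ed = λ { zero → e ; (suc i) → ed i }
    ; inj = λ { zero zero _ → refl
              ; zero (suc j) eq → contradiction (j , sym eq) x∉R
              ; (suc i) zero eq → contradiction (i , eq) x∉R
              ; (suc i) (suc j) eq → cong suc (inj i j eq) }
    ; join = λ { zero → e-joins ; (suc i) → join i }
    }
    where open Ray R

  rayFromIn-on : (P : VSet D) (R : Ray D) → (∀ i → P (Ray.vx R i)) → ∀ i → RayFromIn D P (Ray.vx R i)
  rayFromIn-on P R R⊆P i = dropRay i R , cong (Ray.vx R) (+-identityʳ i) , λ j → R⊆P (i + j)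

  -- Prepending `x` might repeat a vertex; if `x` already lies on the ray, its tail from `x` is
  -- taken instead.
  rayFromIn-step : ExcludedMiddle 0ℓ → (P : VSet D) → ∀ {e x y} →
    Joins D e x y → P x → RayFromIn D P y → RayFromIn D P x
  rayFromIn-step em P {x = x} e-joins px (R , refl , R⊆P) with em {OnRay D R x}
  ... | yes (i , refl) = rayFromIn-on P R R⊆P i
  ... | no x∉R = consRay R e-joins x∉R , refl , λ { zero → px ; (suc i) → R⊆P i }

  reachable-head : ∀ {w} e → Reachable D w (tail e) → Reachable D w (head e)
  reachable-head e (n , r) = suc n , step e r

  outRay-reachable : ∀ {w} ((vx , _) : OutRay D w) → ∀ i → Reachable D w (vx i)
  outRay-reachable (vx , ed , _ , dir , refl) zero = 0 , here
  outRay-reachable ρ@(vx , ed , _ , dir , _) (suc i) =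
    subst (Reachable D _) (proj₂ (dir i))
      (reachable-head (ed i) (subst (Reachable D _) (sym (proj₁ (dir i))) (outRay-reachable ρ i)))

-- Invariance under reversal of all edges

module _ {D : Digraph} where
  open Digraph D

  Joins-op : ∀ {e a b} → Joins (op D) e a b → Joins D e a b
  Joins-op = Sum.swap ∘ Sum.map Product.swap Product.swap

  Cut-op : ∀ {X e} → Cut (op D) X e → Cut D X e
  Cut-op = Sum.swap ∘ Sum.map Product.swap Product.swap

  Ray-op : Ray (op D) → Ray D
  Ray-op R = record { vx = vx ; ed = ed ; inj = inj ; join = Joins-op ∘ join }
    where open Ray R

  Path-op : ∀ {a b} → Path (op D) a b → Path D a b
  Path-op P = record
    { len = len ; vx = vx ; ed = ed ; inj = inj
    ; join = λ i i<len → Joins-op (join i i<len) ; start = start ; end = end }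
    where open Path P

  BeanSubdivision-op : BeanSubdivision (op D) → BeanSubdivision D
  BeanSubdivision-op B = record
    { S = Ray-op S ; R = Ray-op R ; disjSR = disjSR ; f = f ; f0 = f0 ; fmono = fmono
    ; P = Path-op ∘ P ; innS = innS ; innR = innR ; innP = innP }
    where open BeanSubdivision B

  -- The edges of the walk in `op D`, taken from the last one, prolong the walk from `w` until it
  -- arrives at `v`.
  reachable-op : ∀ {v w x} → Reachable (op D) v x → Reachable D w x → Reachable D w v
  reachable-op (_ , here) r = r
  reachable-op (suc n , step e r′) r = reachable-op (n , r′) (reachable-head e r)

module _ {D : Digraph} where
  open Digraph D

  IsNibble-op : ∀ {F} → IsNibble (op D) F → IsNibble D F
  IsNibble-op (X , (F⊆ , ⊆F) , rayless) =
    X , ((λ e → Cut-op {D} {X} ∘ F⊆ e) , (λ e → ⊆F e ∘ Cut-op {op D} {X})) ,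
    λ (R , R⊆X) → rayless (Ray-op {op D} R , R⊆X)

module _ {D : Digraph} where
  open Digraph D

  -- A competitor `F′` has to be moved from `D` to `op D`; `IsNibble-op` does this too, as
  -- `op (op D)` is `D` by eta.
  MinNonEmptyNibble-op : ∀ {F} → MinNonEmptyNibble (op D) F → MinNonEmptyNibble D F
  MinNonEmptyNibble-op (nib , ne , minimal) =
    IsNibble-op {D} nib , ne , λ F′ nib′ → minimal F′ (IsNibble-op {op D} nib′)

  DirectedCut-op : ∀ {F} → DirectedCut (op D) F → DirectedCut D F
  DirectedCut-op (X , (F⊆ , ⊆F) , dir) =
    X , ((λ e → Cut-op {D} {X} ∘ F⊆ e) , (λ e → ⊆F e ∘ Cut-op {op D} {X})) ,
    Sum.swap (Sum.map (λ d e → Product.swap ∘ d e) (λ d e → Product.swap ∘ d e) dir)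

-- The shortest path tree rooted at w

module ShortestPathTree (em : ExcludedMiddle 0ℓ) (D : Digraph) (vw : Digraph.E D) where
  open Digraph D

  v w : V
  v = tail vw
  w = head vw

  A : VSet D
  A = Reachable D w

  -- The distance from w, with value 0 outside A.
  d : V → ℕ
  d x with em {A x}
  ... | yes (_ , r) = proj₁ (least em (λ n → Reach D w n x) r)
  ... | no _ = 0

  d-reach : ∀ {x} → A x → Reach D w (d x) x
  d-reach {x} a with em {A x}
  ... | yes (_ , r) = proj₁ (proj₂ (least em (λ n → Reach D w n x) r))
  ... | no ¬a = contradiction a ¬a

  d-minimal : ∀ {x n} → Reach D w n x → d x ≤ n
  d-minimal {x} {n} r with em {A x}
  ... | yes (_ , r′) = proj₂ (proj₂ (least em (λ n → Reach D w n x) r′)) n r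
  ... | no _ = z≤n

  d>0⇒A : ∀ {x} → 0 < d x → A x
  d>0⇒A {x} 0<d with em {A x}
  ... | yes a = a
  d>0⇒A {x} () | no _

  d-w : d w ≡ 0
  d-w = n≤0⇒n≡0 (d-minimal here)

  TreeEdge : V → Set
  TreeEdge x = Σ[ e ∈ E ] (head e ≡ x × A (tail e) × suc (d (tail e)) ≡ d x)

  -- The last edge of a shortest walk works: a shorter walk to its tail would give a shorter walk to
  -- `x`.
  lastEdge : ∀ {x} → 0 < d x → TreeEdge x
  lastEdge 0<d = go (d-reach (d>0⇒A 0<d)) refl 0<d
    where
    go : ∀ {n x} → Reach D w n x → n ≡ d x → 0 < d x → TreeEdge x
    go here _ 0<d = contradiction (subst (0 <_) d-w 0<d) n≮0
    go (step e r) eq _ =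
      e , refl , (_ , r) , ≤-antisym (≤-trans (s≤s (d-minimal r)) (≤-reflexive eq))
                                     (d-minimal (step e (d-reach (_ , r))))

  -- Junk value: the parent of w and of every vertex outside A is w.
  par : V → V
  par x with em {TreeEdge x}
  ... | yes (e , _) = tail e
  ... | no _ = w

  pe : V → E
  pe x with em {TreeEdge x}
  ... | yes (e , _) = e
  ... | no _ = vw

  pe-edge : ∀ {x} → 0 < d x → tail (pe x) ≡ par x × head (pe x) ≡ x
  pe-edge {x} 0<d with em {TreeEdge x}
  ... | yes (e , eq , _) = refl , eq
  ... | no ¬e = contradiction (lastEdge 0<d) ¬e

  d-par : ∀ x → d (par x) ≡ pred (d x)
  d-par x with em {TreeEdge x}
  ... | yes (e , _ , _ , eq) = cong pred eq
  ... | no ¬e = trans d-w (sym (cong pred (n≤0⇒n≡0 (≮⇒≥ (¬e ∘ lastEdge)))))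

  par-A : ∀ x → A (par x)
  par-A x with em {TreeEdge x}
  ... | yes (_ , _ , a , _) = a
  ... | no _ = 0 , here

  d≡0⇒w : ∀ {x} → A x → d x ≡ 0 → x ≡ w
  d≡0⇒w {x} a eq with subst (λ n → Reach D w n x) eq (d-reach a)
  ... | here = refl

  anc : ℕ → V → V
  anc zero x = x
  anc (suc k) x = par (anc k x)

  anc-+ : ∀ j k x → anc j (anc k x) ≡ anc (j + k) x
  anc-+ zero k x = refl
  anc-+ (suc j) k x = cong par (anc-+ j k x)

  d-anc : ∀ k x → d (anc k x) ≡ d x ∸ k
  d-anc zero x = refl
  d-anc (suc k) x = trans (d-par (anc k x)) (trans (cong pred (d-anc k x)) (pred[m∸n]≡m∸[1+n] (d x) k))

  anc-A : ∀ k {x} → A x → A (anc k x)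
  anc-A zero a = a
  anc-A (suc k) {x} _ = par-A (anc k x)

  anc-root : ∀ {x} → A x → anc (d x) x ≡ w
  anc-root {x} a = d≡0⇒w (anc-A (d x) a) (trans (d-anc (d x) x) (n∸n≡0 (d x)))

  -- The tree order, with `y` the ancestor. The bound stops the climb at the root and leaves only
  -- `k` equal to 0 for `x` outside `A`.
  Below : V → V → Set
  Below x y = Σ[ k ∈ ℕ ] (k ≤ d x × anc k x ≡ y)

  below-d : ∀ {x y} ((k , _) : Below x y) → d y ≡ d x ∸ k
  below-d {x} (k , _ , refl) = d-anc k x

  below-d-≤ : ∀ {x y} → Below x y → d y ≤ d x
  below-d-≤ {x} b@(k , _) = ≤-trans (≤-reflexive (below-d b)) (m∸n≤m (d x) k)

  -- The depths determine the number of steps of a climb.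
  below-unique : ∀ {x y z} → Below x y → Below x z → d y ≡ d z → y ≡ z
  below-unique {x} by@(k , k≤d , refl) bz@(l , l≤d , refl) eq =
    cong (λ i → anc i x)
      (∸-cancelˡ-≡ k≤d l≤d (trans (sym (below-d by)) (trans eq (below-d bz))))

  -- Positive depth excludes the root and the vertices outside `A`, whose junk parent is `w`.
  Child : V → V → Set
  Child c u = 0 < d c × par c ≡ u

  child-d : ∀ {c u} → Child c u → d c ≡ suc (d u)
  child-d {c} (0<d , refl) = trans (suc-pred′ 0<d) (cong suc (sym (d-par c)))
    where
    suc-pred′ : ∀ {n} → 0 < n → n ≡ suc (pred n)
    suc-pred′ (s≤s _) = refl

  module TreePath (x : V) (L : ℕ) (L≤d : L ≤ d x) where

    pvx : ℕ → V
    pvx i = anc (L ∸ i) x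

    ped : ℕ → E
    ped i = pe (pvx (suc i))

    pvx-last : pvx L ≡ x
    pvx-last = cong (λ k → anc k x) (n∸n≡0 L)

    d-pvx : ∀ i → i ≤ L → d (pvx i) ≡ (d x ∸ L) + i
    d-pvx i i≤L = trans (d-anc (L ∸ i) x) (m∸[n∸i]≡[m∸n]+i (d x) L i i≤L L≤d)

    pvx-injective : ∀ i j → i ≤ L → j ≤ L → pvx i ≡ pvx j → i ≡ j
    pvx-injective i j i≤L j≤L eq =
      +-cancelˡ-≡ (d x ∸ L) i j (trans (sym (d-pvx i i≤L)) (trans (cong d eq) (d-pvx j j≤L)))

    ped-edge : ∀ i → i < L → tail (ped i) ≡ pvx i × head (ped i) ≡ pvx (suc i)
    ped-edge i i<L =
      Product.map₁ (λ eq → trans eq (cong (λ k → anc k x) (sym (+-∸-assoc 1 i<L)))) (pe-edge 0<d)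
      where
      0<d : 0 < d (pvx (suc i))
      0<d = subst (0 <_) (sym (trans (d-pvx (suc i) i<L) (+-suc (d x ∸ L) i))) z<s


  -- The tree path from `w` to `v` has `d v` edges; `vw` follows as edge number `L` and leads back
  -- to `w`.
  directedCycle : A v → DirectedCycleThrough D vw
  directedCycle a =
    suc L , cvx , ced , z<s , cvx-injective , ced-edge ,
    trans (cvx-end (suc L) (n<1+n L)) (sym (trans (cvx-pvx 0 z≤n) (anc-root a))) ,
    L , n<1+n L , ced-last
    where
    L = d v
    open TreePath v L ≤-refl
    cvx : ℕ → V
    cvx i with i ≤? L
    ... | yes _ = pvx i
    ... | no _ = w
    ced : ℕ → E
    ced i with suc i ≤? L
    ... | yes _ = ped i
    ... | no _ = vw
    cvx-pvx : ∀ i → i ≤ L → cvx i ≡ pvx i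
    cvx-pvx i i≤L with i ≤? L
    ... | yes _ = refl
    ... | no i≰L = contradiction i≤L i≰L
    cvx-end : ∀ i → L < i → cvx i ≡ w
    cvx-end i L<i with i ≤? L
    ... | yes i≤L = contradiction L<i (≤⇒≯ i≤L)
    ... | no _ = refl
    ced-last : ced L ≡ vw
    ced-last with suc L ≤? L
    ... | yes L<L = contradiction L<L 1+n≰n
    ... | no _ = refl
    cvx-injective : ∀ i j → i < suc L → j < suc L → cvx i ≡ cvx j → i ≡ j
    cvx-injective i j (s≤s i≤L) (s≤s j≤L) eq =
      pvx-injective i j i≤L j≤L (trans (sym (cvx-pvx i i≤L)) (trans eq (cvx-pvx j j≤L)))
    ced-edge : ∀ i → i < suc L → tail (ced i) ≡ cvx i × head (ced i) ≡ cvx (suc i)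
    ced-edge i (s≤s i≤L) with suc i ≤? L
    ... | yes i<L = trans (proj₁ (ped-edge i i<L)) (sym (cvx-pvx i i≤L)) , proj₂ (ped-edge i i<L)
    ... | no i≮L with ≤-antisym i≤L (≮⇒≥ i≮L)
    ...   | refl = sym (trans (cvx-pvx L ≤-refl) pvx-last) , refl

  -- Infinite branching in the tree

  module Branching (no-outRay : ¬ OutRay D w) (R : Ray D)
    (meets : ∀ N → Σ[ j ∈ ℕ ] (N < j × A (Ray.vx R j))) where

    r : ℕ → V
    r = Ray.vx R

    Big : V → Set
    Big x = ∀ N → Σ[ j ∈ ℕ ] (N < j × Below (r j) x)

    big-w : Big w
    big-w N with meets N
    ... | j , N<j , a = j , N<j , d (r j) , ≤-refl , anc-root a

    branching : Σ[ u ∈ V ] (Big u × (∀ c → Child c u → ¬ Big c))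
    branching = ¬¬-elim em λ none → no-outRay (ray none)
      where
      ray : ¬ (Σ[ u ∈ V ] (Big u × (∀ c → Child c u → ¬ Big c))) → OutRay D w
      ray none = vx , pe ∘ vx ∘ suc , injective , edge , refl
        where
        next : ((u , _) : Σ V Big) → Σ[ c ∈ V ] (Child c u × Big c)
        next (u , big) = ¬¬-elim em λ ¬c → none (u , big , λ c ch b → ¬c (c , ch , b))
        state : ℕ → Σ V Big
        state zero = w , big-w
        state (suc i) = proj₁ (next (state i)) , proj₂ (proj₂ (next (state i)))
        vx : ℕ → V
        vx = proj₁ ∘ state
        child : ∀ i → Child (vx (suc i)) (vx i)
        child i = proj₁ (proj₂ (next (state i)))
        d-vx : ∀ i → d (vx i) ≡ i
        d-vx zero = d-w
        d-vx (suc i) = trans (child-d (child i)) (cong suc (d-vx i))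
        injective : ∀ i j → vx i ≡ vx j → i ≡ j
        injective i j eq = trans (sym (d-vx i)) (trans (cong d eq) (d-vx j))
        edge : ∀ i → tail (pe (vx (suc i))) ≡ vx i × head (pe (vx (suc i))) ≡ vx (suc i)
        edge i = Product.map₁ (λ eq → trans eq (proj₂ (child i))) (pe-edge (proj₁ (child i)))

    -- The fan from u to R

    module Fan (u : V) (u-big : Big u) (child-small : ∀ c → Child c u → ¬ Big c) where

      -- All children of `u` have the same depth, so `r i` lies below at most one of them, and that
      -- child is not `Big`.
      siblings-bounded : ∀ i → Σ[ M ∈ ℕ ]
        (∀ j → Σ[ c ∈ V ] (Child c u × Below (r i) c × Below (r j) c) → j ≤ M)
      siblings-bounded i with em {Σ[ c ∈ V ] (Child c u × Below (r i) c)}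
      ... | no ¬c = 0 , λ { j (c , ch , b , _) → contradiction (c , ch , b) ¬c }
      ... | yes (c , ch , b) with unbounded-or-bounded em (λ j → Below (r j) c)
      ...   | inj₁ big = contradiction big (child-small c ch)
      ...   | inj₂ (M , bound) = M , λ { j (c′ , ch′ , b′ , bj) → bound j
              (subst (Below (r j)) (below-unique b′ b (trans (child-d ch′) (sym (child-d ch)))) bj) }

      -- Each of the finitely many ancestors of `u` occurs at most once on `R`. Beyond the bound,
      -- `R` avoids the tree path from `w` to `u`.
      ancestors-bounded : Σ[ M ∈ ℕ ] (∀ i j → i ≤ d u → anc i u ≡ r j → j ≤ M)
      ancestors-bounded = uniform-bound (λ i j → anc i u ≡ r j)
        (λ i → functional-bounded em λ j k eq eq′ → Ray.inj R j k (trans (sym eq) eq′)) (d u)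

      N₀ : ℕ
      N₀ = proj₁ ancestors-bounded

      ancestor-index : ∀ {j} → Below u (r j) → j ≤ N₀
      ancestor-index (i , i≤d , eq) = proj₂ ancestors-bounded i _ i≤d eq

      -- By minimality of d (r j), the tree path from u to r j meets R after u only in r j.
      record Leaf (N j : ℕ) : Set where
        field
          {c}     : V
          child   : Child c u
          below   : Below (r j) c
          beyond  : ∀ i → Below (r i) c → N < i
          minimal : ∀ i → Below (r i) c → d (r j) ≤ d (r i)

      -- A descendant of `u` on `R` is chosen beyond two bounds: past `N₀` it differs from `u`, and
      -- past `M` its branch at `u` contains no `r i` with `i` at most `N`. The leaf is a shallowest
      -- vertex of `R` in that branch.
      nextLeaf : ∀ N → Σ[ j ∈ ℕ ] Leaf N j
      nextLeaf N = choose (u-big (N₀ ⊔ M))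
        where
        M = proj₁ (uniform-bound _ siblings-bounded N)
        sibling≤M = proj₂ (uniform-bound _ siblings-bounded N)
        choose : Σ[ j ∈ ℕ ] (N₀ ⊔ M < j × Below (r j) u) → Σ[ j ∈ ℕ ] Leaf N j
        choose (j , N₀⊔M<j , zero , _ , eq) =
          contradiction (ancestor-index (0 , z≤n , sym eq)) (<⇒≱ (≤-<-trans (m≤m⊔n N₀ M) N₀⊔M<j))
        -- The climb to `u` takes `suc k` steps, so the child starting the branch is `anc k (r j)`.
        choose (j , N₀⊔M<j , suc k , k<d , eq) with
          least em (λ m → Σ[ i ∈ ℕ ] (Below (r i) (anc k (r j)) × d (r i) ≡ m)) (j , (k , <⇒≤ k<d , refl) , refl)
        ... | m , (i , b , refl) , min = i , record
          { child = child
          ; below = b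
          ; beyond = λ i b → ≰⇒> λ i≤N →
              contradiction (sibling≤M i j i≤N (_ , child , b , k , <⇒≤ k<d , refl))
                            (<⇒≱ (≤-<-trans (m≤n⊔m N₀ M) N₀⊔M<j))
          ; minimal = λ i b → min _ (i , b , refl)
          }
          where
          child : Child (anc k (r j)) u
          child = subst (0 <_) (sym (d-anc k (r j))) (m<n⇒0<n∸m k<d) , eq

      state : ℕ → Σ[ N ∈ ℕ ] Σ[ j ∈ ℕ ] Leaf N j
      state zero = N₀ , nextLeaf N₀
      state (suc k) = proj₁ (proj₂ (state k)) , nextLeaf (proj₁ (proj₂ (state k)))

      N F : ℕ → ℕ
      N k = proj₁ (state k)
      F k = proj₁ (proj₂ (state k))

      leaf : ∀ k → Leaf (N k) (F k)
      leaf k = proj₂ (proj₂ (state k))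

      c : ℕ → V
      c k = Leaf.c (leaf k)

      child : ∀ k → Child (c k) u
      child k = Leaf.child (leaf k)

      N<F : ∀ k → N k < F k
      N<F k = Leaf.beyond (leaf k) (F k) (Leaf.below (leaf k))

      F-mono : ∀ {k l} → k ≤ l → F k ≤ F l
      F-mono {l = zero} z≤n = ≤-refl
      F-mono {k} {suc l} k≤1+l with m≤n⇒m<n∨m≡n k≤1+l
      ... | inj₁ (s≤s k≤l) = ≤-trans (F-mono k≤l) (<⇒≤ (N<F (suc l)))
      ... | inj₂ refl = ≤-refl

      F≤N : ∀ {k l} → k < l → F k ≤ N l
      F≤N {l = suc l} (s≤s k≤l) = F-mono k≤l

      -- Equality would put `r (F k)` below `c l`, where `beyond` allows only indices above `N l`.
      c-distinct : ∀ {k l} → k < l → c k ≢ c l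
      c-distinct {k} {l} k<l eq = contradiction
        (Leaf.beyond (leaf l) (F k) (subst (Below (r (F k))) eq (Leaf.below (leaf k))))
        (≤⇒≯ (F≤N k<l))

      c-injective : ∀ {k l} → c k ≡ c l → k ≡ l
      c-injective {k} {l} eq with <-cmp k l
      ... | tri< k<l _ _ = contradiction eq (c-distinct k<l)
      ... | tri≈ _ k≡l _ = k≡l
      ... | tri> _ _ l<k = contradiction (sym eq) (c-distinct l<k)

      height : ℕ → ℕ
      height k = proj₁ (Leaf.below (leaf k))

      height<d : ∀ k → suc (height k) ≤ d (r (F k))
      height<d k = m∸n≢0⇒n<m λ eq → contradiction
        (subst (0 <_) (trans (below-d (Leaf.below (leaf k))) eq) (proj₁ (child k))) n≮0

      module _ (k : ℕ) where
        open TreePath (r (F k)) (suc (height k)) (height<d k)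

        -- Endpoints are taken up to equality, since those required in `bean` agree with `u` and
        -- `r (F k)` only propositionally.
        fanPath : ∀ {x y} → u ≡ x × r (F k) ≡ y → Path D x y
        fanPath (u≡x , eq) = record
          { len = suc (height k)
          ; vx = pvx
          ; ed = ped
          ; inj = pvx-injective
          ; join = λ i i<L → inj₁ (ped-edge i i<L)
          ; start = trans (cong par (proj₂ (proj₂ (Leaf.below (leaf k))))) (trans (proj₂ (child k)) u≡x)
          ; end = trans pvx-last eq
          }

        inner-below : ∀ {x y z} (eqs : u ≡ x × r (F k) ≡ y) → Inner D (fanPath eqs) z → Below z (c k)
        inner-below eqs (suc i , _ , s≤s i<h , refl) =
          -- `c k` is vertex number 1 of the path, so `i` steps lead up to it from vertex `suc i`.
          i ,
          subst (i ≤_) (sym (d-pvx (suc i) (s≤s (<⇒≤ i<h)))) (≤-trans (n≤1+n i) (m≤n+m (suc i) _)) ,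
          trans (anc-+ i (height k ∸ i) _)
            (trans (cong (λ m → anc m (r (F k))) (m+[n∸m]≡n (<⇒≤ i<h))) (proj₂ (proj₂ (Leaf.below (leaf k)))))

        inner-d : ∀ {x y z} (eqs : u ≡ x × r (F k) ≡ y) → Inner D (fanPath eqs) z → d z < d (r (F k))
        inner-d eqs (suc i , _ , s≤s i<h , refl) =
          subst (_< d (r (F k))) (sym (d-anc (height k ∸ i) (r (F k))))
            (∸-monoʳ-< {o = 0} (m<n⇒0<n∸m i<h) (≤-trans (m∸n≤m (height k) i) (<⇒≤ (height<d k))))

        inner-∉R : ∀ {x y z} (eqs : u ≡ x × r (F k) ≡ y) → Inner D (fanPath eqs) z → ¬ OnRay D R z
        inner-∉R eqs inn (i , refl) =
          <⇒≱ (inner-d eqs inn) (Leaf.minimal (leaf k) i (inner-below eqs inn))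

        inner-d> : ∀ {x y z} (eqs : u ≡ x × r (F k) ≡ y) → Inner D (fanPath eqs) z → d u < d z
        inner-d> eqs inn = ≤-trans (≤-reflexive (sym (child-d (child k)))) (below-d-≤ (inner-below eqs inn))

      u∈A : A u
      u∈A = subst A (proj₂ (child 0)) (par-A (c 0))

      -- First `w` and then the other ancestors of `u`, down to `u` itself, are prepended to the ray
      -- at `v`. In `climb`, `k` is the height above `u` and `m` the distance left to `w`.
      rayFrom-u : ∀ {U : VSet D} → RayFromIn D U v → RayFromIn D (λ x → Below u x ⊎ U x) u
      rayFrom-u {U} (S , S₀≡v , S⊆U) = climb (d u) 0 refl
        where
        P : VSet D
        P x = Below u x ⊎ U x
        climb : ∀ m k → k + m ≡ d u → RayFromIn D P (anc k u)
        climb zero k eq = subst (RayFromIn D P) (sym anc≡w)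
          (rayFromIn-step em P (inj₂ (refl , refl)) (inj₁ (k , k≤d , anc≡w)) (S , S₀≡v , inj₂ ∘ S⊆U))
          where
          k≡d = trans (sym (+-identityʳ k)) eq
          k≤d = ≤-reflexive k≡d
          anc≡w : anc k u ≡ w
          anc≡w = trans (cong (λ i → anc i u) k≡d) (anc-root u∈A)
        climb (suc m) k eq =
          rayFromIn-step em P (inj₂ (pe-edge 0<d)) (inj₁ (k , <⇒≤ k<d , refl)) (climb m (suc k) eq′)
          where
          eq′ = trans (sym (+-suc k m)) eq
          k<d : k < d u
          k<d = subst (suc k ≤_) eq′ (m≤m+n (suc k) m)
          0<d : 0 < d (anc k u)
          0<d = subst (0 <_) (sym (d-anc k u)) (m<n⇒0<n∸m k<d)

      bean : ∀ {U : VSet D} → (∀ {x} → U x → ¬ A x) → (∀ i → ¬ U (r i)) →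
        RayFromIn D U v → BeanSubdivision D
      bean {U} U∩A R∩U ρ with rayFrom-u {U} ρ
      ... | S , S₀≡u , S⊆ = record
        { S = S
        -- Cut at the first leaf, the ray starts at a branch vertex and lies beyond every ancestor
        -- of `u`.
        ; R = dropRay (F 0) R
        ; disjSR = λ i j eq → [ (λ b → contradiction
                                    (ancestor-index (subst (Below u) eq b))
                                    (<⇒≱ (<-≤-trans (N<F 0) (m≤m+n (F 0) j))))
                              , (λ x∈U → R∩U (F 0 + j) (subst U eq x∈U)) ]′ (S⊆ i)
        ; f = λ k → F k ∸ F 0
        ; f0 = n∸n≡0 (F 0)
        ; fmono = λ k → ∸-monoˡ-< (N<F (suc k)) (F-mono {0} {k} z≤n)
        ; P = λ k → fanPath k (ends k)
        -- Inner vertices are deeper than `u`, so they are not ancestors of `u` and do lie in `A`.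
        ; innS = λ { k x inn (i , refl) →
            [ (λ b → <⇒≱ (inner-d> k (ends k) inn) (below-d-≤ b))
            , (λ x∈U → U∩A x∈U (d>0⇒A (≤-trans (s≤s z≤n) (inner-d> k (ends k) inn)))) ]′ (S⊆ i) }
        ; innR = λ { k x inn (i , eq) → inner-∉R k (ends k) inn (F 0 + i , eq) }
        ; innP = λ k l x inn inn′ → c-injective
            (below-unique (inner-below k (ends k) inn) (inner-below l (ends l) inn′)
              (trans (child-d (child k)) (sym (child-d (child l)))))
        }
        where
        ends : ∀ k → u ≡ Ray.vx S 0 × r (F k) ≡ r (F 0 + (F k ∸ F 0))
        ends k = sym S₀≡u , cong r (sym (m+[n∸m]≡n (F-mono {0} {k} z≤n)))

  -- Every edge of a walk from `w` has its tail in `A`, so membership in `X` cannot change along the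
  -- walk.
  A-connected : ∀ {X : VSet D} → (∀ e → A (tail e) → ¬ Cut D X e) →
    ∀ {a} → A a → (X w → X a) × (X a → X w)
  A-connected {X} uncut (_ , r) = go r
    where
    go : ∀ {n a} → Reach D w n a → (X w → X a) × (X a → X w)
    go here = (λ x → x) , (λ x → x)
    go (step e r) = Cut-respects D em X e (inj₁ (refl , refl)) e∉ ∘ proj₁ (go r) ,
                    proj₂ (go r) ∘ Cut-respects D em X e (inj₂ (refl , refl)) e∉
      where e∉ = uncut e (_ , r)

  -- Directed minimal nibbles

  module Nibble (no-bean : ¬ BeanSubdivision D) (no-outRay : ¬ OutRay D w) (v∉A : ¬ A v) where

    HasNibble : Set₁
    HasNibble = Σ[ F ∈ ESet D ] (MinNonEmptyNibble D F × DirectedCut D F × F vw)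

    Avoids : VSet D
    Avoids x = ¬ A x

    U : VSet D
    U = RayFromIn D Avoids

    U∩A : ∀ {x} → U x → ¬ A x
    U∩A (S , refl , S∩A) = S∩A 0

    U-step : ∀ {e x y} → Joins D e x y → ¬ A x → U y → U x
    U-step = rayFromIn-step em Avoids

    data C : VSet D where
      base : C v
      step : ∀ {e x y} → C x → Joins D e x y → ¬ A y → C y

    C∩A : ∀ {x} → C x → ¬ A x
    C∩A base = v∉A
    C∩A (step _ _ y∉A) = y∉A

    C-U : ∀ {x} → C x → U x → U v
    C-U base ρ = ρ
    C-U (step c e-joins _) ρ = C-U c (U-step e-joins (C∩A c) ρ)

    C-connected : ∀ {X : VSet D} → (∀ {e x y} → Joins D e x y → C x → C y → ¬ Cut D X e) →
      ∀ {x} → C x → (X v → X x) × (X x → X v)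
    C-connected uncut base = (λ x → x) , (λ x → x)
    C-connected {X} uncut c@(step {e} c′ e-joins _) =
      Cut-respects D em X e e-joins (uncut e-joins c′ c) ∘ proj₁ ih ,
      proj₂ ih ∘ Cut-respects D em X e (Sum.swap e-joins) (uncut e-joins c′ c)
      where ih = C-connected {X} uncut c′

    C-rayless : ¬ U v → Rayless D C
    C-rayless v∉U (R , R⊆C) = v∉U (C-U (R⊆C 0) (rayFromIn-on Avoids R (C∩A ∘ R⊆C) 0))

    -- `C` absorbs its neighbours outside `A`, so the other end is in `A`. It is the head, since an
    -- edge with tail in `A` has its head in `A`.
    cut-C : ∀ e → Cut D C e → C (tail e) × A (head e)
    cut-C e (inj₁ (ct , ¬ch)) = ct , ¬¬-elim em λ h∉A → ¬ch (step ct (inj₁ (refl , refl)) h∉A)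
    cut-C e (inj₂ (¬ct , ch)) = contradiction
      (step ch (inj₂ (refl , refl)) (C∩A ch ∘ reachable-head e)) ¬ct

    C-nibble : ¬ U v → HasNibble
    C-nibble v∉U =
      Cut D C ,
      ((C , ((λ _ p → p) , (λ _ p → p)) , C-rayless v∉U) , (vw , vw∈) , minimal) ,
      (C , ((λ _ p → p) , (λ _ p → p)) , inj₁ λ e e∈ → Product.map₂ (λ a c → C∩A c a) (cut-C e e∈)) ,
      vw∈
      where
      vw∈ : Cut D C vw
      vw∈ = inj₁ (base , λ cw → C∩A cw (0 , here))
      -- All edges of the cut of `X` lead from `C` to `A`, so `X` is constant on both sets. Cutting
      -- the single edge `e′` thus means cutting all edges from `C` to `A`.
      minimal : ∀ F′ → IsNibble D F′ → NonEmpty D F′ → _⊆_ D F′ (Cut D C) → _⊆_ D (Cut D C) F′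
      minimal F′ (X , (F′⊆ , ⊆F′) , _) (e′ , e′∈) F′⊆C e e∈ =
        ⊆F′ e (Sum.map (Product.map from-C from-A′) (Product.map from-C′ from-A) (F′⊆ e′ e′∈))
        where
        cut⊆C : ∀ {e} → Cut D X e → Cut D C e
        cut⊆C {e} = F′⊆C e ∘ ⊆F′ e
        onA = λ {a} → A-connected {X} (λ e t∈A e∈ → C∩A (proj₁ (cut-C e (cut⊆C e∈))) t∈A) {a}
        onC = λ {x} → C-connected {X} (λ { (inj₁ (refl , refl)) _ cy e∈ → C∩A cy (proj₂ (cut-C _ (cut⊆C e∈)))
                                         ; (inj₂ (refl , refl)) cx _ e∈ → C∩A cx (proj₂ (cut-C _ (cut⊆C e∈))) }) {x}
        ct′ = proj₁ (cut-C e′ (F′⊆C e′ e′∈))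
        ah′ = proj₂ (cut-C e′ (F′⊆C e′ e′∈))
        ct = proj₁ (cut-C e e∈)
        ah = proj₂ (cut-C e e∈)
        from-C : X (tail e′) → X (tail e)
        from-C = proj₁ (onC ct) ∘ proj₂ (onC ct′)
        from-C′ : ¬ X (tail e′) → ¬ X (tail e)
        from-C′ ¬x = ¬x ∘ proj₁ (onC ct′) ∘ proj₂ (onC ct)
        from-A : X (head e′) → X (head e)
        from-A = proj₁ (onA ah) ∘ proj₂ (onA ah′)
        from-A′ : ¬ X (head e′) → ¬ X (head e)
        from-A′ ¬x = ¬x ∘ proj₁ (onA ah′) ∘ proj₂ (onA ah)

    Uᶜ : VSet D
    Uᶜ x = ¬ U x

    -- If `R` meets `A` only finitely often, a tail of it avoids `A` and starts in `U`; otherwise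
    -- the fan yields a Bean subdivision.
    Uᶜ-rayless : U v → Rayless D Uᶜ
    Uᶜ-rayless (S , S₀≡v , S∩A) (R , R∩U) with unbounded-or-bounded em (λ j → A (Ray.vx R j))
    ... | inj₂ (M , bound) =
      R∩U (suc M) (dropRay (suc M) R , cong (Ray.vx R) (+-identityʳ (suc M)) ,
                   λ i a → <⇒≱ (m≤m+n (suc M) i) (bound (suc M + i) a))
    ... | inj₁ meets = no-bean
      (bean {U} U∩A R∩U (S , S₀≡v , rayFromIn-on Avoids S S∩A))
      where
      open Branching no-outRay R meets
      open Fan (proj₁ branching) (proj₁ (proj₂ branching)) (proj₂ (proj₂ branching))

    -- The argument of `cut-C`, with `U-step` absorbing neighbours outside `A`.
    cut-Uᶜ : ∀ e → Cut D Uᶜ e → U (tail e) × A (head e)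
    cut-Uᶜ e (inj₁ (t∉U , ¬¬h∈U)) = contradiction
      (U-step (inj₁ (refl , refl)) (U∩A h∈U ∘ reachable-head e) h∈U) t∉U
      where h∈U = ¬¬-elim em ¬¬h∈U
    cut-Uᶜ e (inj₂ (¬¬t∈U , h∉U)) =
      t∈U , ¬¬-elim em λ h∉A → h∉U (U-step (inj₂ (refl , refl)) h∉A t∈U)
      where t∈U = ¬¬-elim em ¬¬t∈U

    Uᶜ-nibble : U v → HasNibble
    Uᶜ-nibble v∈U =
      Cut D Uᶜ ,
      ((Uᶜ , ((λ _ p → p) , (λ _ p → p)) , Uᶜ-rayless v∈U) , (vw , vw∈) , minimal) ,
      (Uᶜ , ((λ _ p → p) , (λ _ p → p)) ,
        inj₂ λ e e∈ → Product.map (λ t∈U t∉U → t∉U t∈U) (λ h∈A h∈U → U∩A h∈U h∈A) (cut-Uᶜ e e∈)) ,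
      vw∈
      where
      vw∈ : Cut D Uᶜ vw
      vw∈ = inj₂ ((λ v∉U → v∉U v∈U) , λ w∈U → U∩A w∈U (0 , here))
      -- A ray avoiding `A` has no edge in the cut of `X`, so starting in `X` it would stay there,
      -- against `rayless`. Hence `X` misses `U`, the end of `e′` in `X` is its head, and all of `A`
      -- lies in `X`.
      minimal : ∀ F′ → IsNibble D F′ → NonEmpty D F′ → _⊆_ D F′ (Cut D Uᶜ) → _⊆_ D (Cut D Uᶜ) F′
      minimal F′ (X , (F′⊆ , ⊆F′) , rayless) (e′ , e′∈) F′⊆U e e∈ =
        ⊆F′ e (inj₂ (U∩X (proj₁ (cut-Uᶜ e e∈)) , proj₁ (onA (proj₂ (cut-Uᶜ e e∈))) w∈X))
        where
        cut-X : ∀ {e} → Cut D X e → U (tail e) × A (head e)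
        cut-X {e} = cut-Uᶜ e ∘ F′⊆U e ∘ ⊆F′ e
        onA = λ {a} → A-connected {X} (λ e t∈A e∈ → U∩A (proj₁ (cut-X e∈)) t∈A) {a}
        U∩X : ∀ {x} → U x → ¬ X x
        U∩X (S , refl , S∩A) x∈X = rayless (S , S⊆X)
          where
          uncut : ∀ {e} i → Joins D e (Ray.vx S i) (Ray.vx S (suc i)) → ¬ Cut D X e
          uncut i (inj₁ (_ , y≡)) e∈ = S∩A (suc i) (subst A y≡ (proj₂ (cut-X e∈)))
          uncut i (inj₂ (_ , y≡)) e∈ = S∩A i (subst A y≡ (proj₂ (cut-X e∈)))
          S⊆X : ∀ i → X (Ray.vx S i)
          S⊆X zero = x∈X
          S⊆X (suc i) = Cut-respects D em X (Ray.ed S i) (Ray.join S i) (uncut i (Ray.join S i)) (S⊆X i)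
        w∈X : X w
        w∈X = [ (λ (t∈X , _) → contradiction t∈X (U∩X (proj₁ (cut-Uᶜ e′ (F′⊆U e′ e′∈)))))
              , (λ (_ , h∈X) → proj₂ (onA (proj₂ (cut-Uᶜ e′ (F′⊆U e′ e′∈)))) h∈X) ]′ (F′⊆ e′ e′∈)

    nibble : HasNibble
    nibble with em {U v}
    ... | yes v∈U = Uᶜ-nibble v∈U
    ... | no v∉U = C-nibble v∉U

  -- A common vertex of the two rays would make `v` reachable from `w`.
  doubleRay : ¬ A v → OutRay D w → OutRay (op D) v → DirectedDoubleRayThrough D vw
  doubleRay v∉A ρ⁺@(x⁺ , e⁺ , inj⁺ , dir⁺ , x⁺₀≡w) ρ⁻@(x⁻ , e⁻ , inj⁻ , dir⁻ , x⁻₀≡v) =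
    vx , ed , injective , edge , -[1+ 0 ] , refl
    where
    vx : ℤ → V
    vx (+ n) = x⁺ n
    vx -[1+ n ] = x⁻ n
    -- An edge carries the index of its tail. As `v` sits at -1, so does `vw`, and `e⁻ n` with tail
    -- `x⁻ (suc n)` gets -(n + 2).
    ed : ℤ → E
    ed (+ n) = e⁺ n
    ed -[1+ 0 ] = vw
    ed -[1+ suc n ] = e⁻ n
    disjoint : ∀ m n → x⁺ m ≢ x⁻ n
    disjoint m n eq = v∉A (reachable-op (outRay-reachable ρ⁻ n) (subst A eq (outRay-reachable ρ⁺ m)))
    injective : ∀ i j → vx i ≡ vx j → i ≡ j
    injective (+ m) (+ n) eq = cong +_ (inj⁺ m n eq)
    injective (+ m) -[1+ n ] eq = contradiction eq (disjoint m n)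
    injective -[1+ m ] (+ n) eq = contradiction (sym eq) (disjoint n m)
    injective -[1+ m ] -[1+ n ] eq = cong -[1+_] (inj⁻ m n eq)
    edge : ∀ i → tail (ed i) ≡ vx i × head (ed i) ≡ vx (i ℤ.+ ℤ.1ℤ)
    edge (+ n) rewrite +-comm n 1 = dir⁺ n
    edge -[1+ 0 ] = sym x⁻₀≡v , sym x⁺₀≡w
    edge -[1+ suc n ] = Product.swap (dir⁻ n)

-- The case distinction

theorem5p34 : ExcludedMiddle 0ℓ → ExcludedMiddle (Level.suc 0ℓ) →
    (D : Digraph) → ¬ BeanSubdivision D → (vw : Digraph.E D) →
    DirectedCycleThrough D vw
    ⊎ DirectedDoubleRayThrough D vw
    ⊎ (Σ[ F ∈ ESet D ] (MinNonEmptyNibble D F × DirectedCut D F × F vw))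
theorem5p34 em _ D no-bean vw = decide em em em
  where
  open ShortestPathTree em D vw
  -- In `op D` the edge `vw` runs from `w` to `v`, which exchanges the roles of the two ends.
  open ShortestPathTree em (op D) vw using () renaming (module Nibble to Nibble⁻)

  decide : Dec (A v) → Dec (OutRay D w) → Dec (OutRay (op D) v) → _
  decide (yes v∈A) _ _ = inj₁ (directedCycle v∈A)
  decide (no v∉A) (yes ρ⁺) (yes ρ⁻) = inj₂ (inj₁ (doubleRay v∉A ρ⁺ ρ⁻))
  decide (no v∉A) (no ¬ρ⁺) _ = inj₂ (inj₂ (Nibble.nibble no-bean ¬ρ⁺ v∉A))
  decide (no v∉A) _ (no ¬ρ⁻) = inj₂ (inj₂ (F , MinNonEmptyNibble-op min , DirectedCut-op dir , vw∈F))
    where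
    reversed = Nibble⁻.nibble (no-bean ∘ BeanSubdivision-op) ¬ρ⁻ (λ r → v∉A (reachable-op r (0 , here)))
    F = proj₁ reversed
    min = proj₁ (proj₂ reversed)
    dir = proj₁ (proj₂ (proj₂ reversed))
    vw∈F = proj₂ (proj₂ (proj₂ reversed))
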